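{- There exist absolute constants $C>0$ and $M_0\in\mathbb N$ such that for all $M,N\in\mathbb N$ with $M\geq M_0$ and $N\geq e^{CM^7}$, \[\frac{D(N)}{N}\leq\frac{3}{4}\,\frac{D(M)}{M}.\]
   Context: For $N\in\mathbb N$, $D(N)$ denotes the maximum size of a subset $A\subseteq\{1,\dots,N\}$ that contains no two distinct elements whose difference is a perfect (non-zero) square, i.e. there are no $a,a'\in A$ and $n\in\mathbb N$, $n\geq 1$, with $a-a'=n^2$. -}

module Defs where

open import Data.Nat using (ℕ; _+_; _*_; _^_; _≤_)
open import Data.List using (List; length)
open import Data.List.Membership.Propositional using (_∈_)
open import Data.List.Relation.Unary.All using (All)
open import Data.List.Relation.Unary.Unique.Propositional using (Unique)
open import Data.Product using (_×_; ∃)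
open import Relation.Binary.PropositionalEquality using (_≡_; _≢_)

record SquareDiffFree (N : ℕ) (A : List ℕ) : Set where
  field
    unique   : Unique A
    inRange  : All (λ a → 1 ≤ a × a ≤ N) A
    noSquare : ∀ {a a'} → a ∈ A → a' ∈ A → ∀ n → 1 ≤ n → a ≢ a' + n ^ 2

IsD : ℕ → ℕ → Set
IsD N d = (∃ λ A → SquareDiffFree N A × length A ≡ d)
        × (∀ A → SquareDiffFree N A → length A ≤ d)

{-# OPTIONS --safe #-}
module Submission where

-- Suppose D(N)/N > (3/4) D(M)/M, realised by a set A with indicator f, and put q = (H!)² with
-- H ≍ M². As q is a square, A meets every M-term progression of step q in at most D(M) points.
-- Let Φ be the sum of f over progressions of step q with R = 4M² terms, and G = R f - Φ the
-- balanced function. By van der Corput differencing, summing G(x + m²) over H consecutive m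
-- leaves, besides the diagonal, correlations of G along the shifts (m+h)² - m², which are linear
-- in m with step 2h dividing q: there G telescopes. So G(x + m²) averages to nearly 0 in mean
-- square, and f(x + m²) behaves like Φ(x + m²)/R. Since f and Φ have average density above 3/4
-- of their maximum D(M)/M, the correlation of f(x) with Φ(x + m²) is large, and hence so is
-- that of f(x) with f(x + m²): A contains a square difference.

open import Defs
open import Data.List using (List; []; _∷_; length; map)
open import Data.List.Membership.Propositional using (_∈_; _∉_)
open import Data.List.Membership.Propositional.Properties using (∈-map⁻)
open import Data.List.Properties using (length-map)
open import Data.List.Relation.Unary.All using (All; []; _∷_)
import Data.List.Relation.Unary.All as All
import Data.List.Relation.Unary.All.Properties as All
open import Data.List.Relation.Unary.AllPairs using ([]; _∷_)
open import Data.List.Relation.Unary.Any using (here)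
open import Data.List.Relation.Unary.Unique.Propositional using (Unique)
import Data.List.Relation.Unary.Unique.Propositional.Properties as Unique
import Data.Nat as ℕ
import Data.Nat.Properties as ℕ
open import Data.Product using (∃; ∃₂; _×_; _,_)
open import Relation.Nullary using (¬_)
open import Relation.Binary.PropositionalEquality
  using (_≡_; _≢_; refl; sym; trans; cong; cong₂; subst; subst₂)

module SquareDifferences where

  open import Data.Empty using (⊥)
  open import Data.Integer
    using (ℤ; +_; -[1+_]; -_; _+_; _*_; _-_; _≤_; _<_; 0ℤ; 1ℤ; +≤+; +<+)
  import Data.Integer.Properties as ℤ
  import Data.Integer as ℤ using (positive)
  open import Data.Integer.Tactic.RingSolver using (solve-∀)
  open import Data.List.Membership.DecPropositional ℕ._≟_ using (_∈?_)
  open import Data.Nat using (ℕ; zero; suc; z≤n; s≤s; _!; _^_)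
  open import Data.Nat.Divisibility using (divides; *-pres-∣; m∣m*n; ∣-trans; m≤n⇒m!∣n!)
  import Data.Nat.Tactic.RingSolver as ℕ-Solver
  open import Relation.Nullary using (Dec; yes; no; contradiction)
  open import Relation.Unary using (Decidable)

  -- Inequalities and finite sums over the integers.

  -- Most polynomial inequalities below are proved this way: the excess `e` is written as a sum of
  -- products of nonnegative quantities, and the ring solver checks the identity.
  ≤-diff : ∀ {a b e} → b ≡ a + e → 0ℤ ≤ e → a ≤ b
  ≤-diff {a} {b} {e} b≡a+e 0≤e =
    subst₂ _≤_ (ℤ.+-identityʳ a) (sym b≡a+e) (ℤ.+-monoʳ-≤ a 0≤e)

  0≤+ : ∀ {a b} → 0ℤ ≤ a → 0ℤ ≤ b → 0ℤ ≤ a + b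
  0≤+ = ℤ.+-mono-≤

  0≤* : ∀ {a b} → 0ℤ ≤ a → 0ℤ ≤ b → 0ℤ ≤ a * b
  0≤* {+ m} {+ n} (+≤+ _) (+≤+ _) = subst (0ℤ ≤_) (ℤ.pos-* m n) (+≤+ z≤n)

  0<* : ∀ {a b} → 0ℤ < a → 0ℤ < b → 0ℤ < a * b
  0<* {+ suc m} {+ suc n} (+<+ _) (+<+ _) = +<+ (s≤s z≤n)

  0≤² : ∀ a → 0ℤ ≤ a * a
  0≤² (+ n) = 0≤* (+≤+ (z≤n {n})) (+≤+ z≤n)
  0≤² -[1+ n ] = +≤+ z≤n

  gap : ∀ {a b} → a ≤ b → 0ℤ ≤ b - a
  gap = ℤ.i≤j⇒0≤j-i

  ∑ : ℕ → (ℕ → ℤ) → ℤ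
  ∑ zero    f = 0ℤ
  ∑ (suc n) f = ∑ n f + f n

  infix 10 ∑
  syntax ∑ n (λ i → e) = ∑[ i < n ] e

  ∑-cong-< : ∀ n {f g} → (∀ i → i ℕ.< n → f i ≡ g i) → ∑ n f ≡ ∑ n g
  ∑-cong-< zero    eq = refl
  ∑-cong-< (suc n) eq =
    cong₂ _+_ (∑-cong-< n (λ i i<n → eq i (ℕ.m<n⇒m<1+n i<n))) (eq n ℕ.≤-refl)

  ∑-cong : ∀ n {f g} → (∀ i → f i ≡ g i) → ∑ n f ≡ ∑ n g
  ∑-cong n eq = ∑-cong-< n (λ i _ → eq i)

  ∑-mono-< : ∀ n {f g} → (∀ i → i ℕ.< n → f i ≤ g i) → ∑ n f ≤ ∑ n g
  ∑-mono-< zero    le = ℤ.≤-refl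
  ∑-mono-< (suc n) le =
    ℤ.+-mono-≤ (∑-mono-< n (λ i i<n → le i (ℕ.m<n⇒m<1+n i<n))) (le n ℕ.≤-refl)

  ∑-mono : ∀ n {f g} → (∀ i → f i ≤ g i) → ∑ n f ≤ ∑ n g
  ∑-mono n le = ∑-mono-< n (λ i _ → le i)

  ∑-distrib-+ : ∀ n f g → ∑[ i < n ] (f i + g i) ≡ ∑ n f + ∑ n g
  ∑-distrib-+ zero    f g = refl
  ∑-distrib-+ (suc n) f g =
    trans (cong (_+ (f n + g n)) (∑-distrib-+ n f g)) (interchange (∑ n f) (∑ n g) (f n) (g n))
    where
    interchange : ∀ a b c d → a + b + (c + d) ≡ a + c + (b + d)
    interchange = solve-∀

  *-distribˡ-∑ : ∀ n c f → ∑[ i < n ] (c * f i) ≡ c * ∑ n f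
  *-distribˡ-∑ zero    c f = sym (ℤ.*-zeroʳ c)
  *-distribˡ-∑ (suc n) c f =
    trans (cong (_+ c * f n) (*-distribˡ-∑ n c f)) (sym (ℤ.*-distribˡ-+ c _ _))

  *-distribʳ-∑ : ∀ n c f → ∑[ i < n ] (f i * c) ≡ ∑ n f * c
  *-distribʳ-∑ n c f =
    trans (∑-cong n (λ i → ℤ.*-comm (f i) c)) (trans (*-distribˡ-∑ n c f) (ℤ.*-comm c _))

  ∑-distrib-− : ∀ n f g → ∑[ i < n ] (f i - g i) ≡ ∑ n f - ∑ n g
  ∑-distrib-− zero    f g = refl
  ∑-distrib-− (suc n) f g =
    trans (cong (_+ (f n - g n)) (∑-distrib-− n f g)) (interchange (∑ n f) (∑ n g) (f n) (g n))
    where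
    interchange : ∀ a b c d → a - b + (c - d) ≡ a + c - (b + d)
    interchange = solve-∀

  ∑-const : ∀ n c → ∑[ i < n ] c ≡ + n * c
  ∑-const zero    c = sym (ℤ.*-zeroˡ c)
  ∑-const (suc n) c = trans (cong (_+ c) (∑-const n c)) (rearrange (+ n) c)
    where
    rearrange : ∀ a c → a * c + c ≡ (1ℤ + a) * c
    rearrange = solve-∀

  ∑-swap : ∀ m n (f : ℕ → ℕ → ℤ) →
           ∑[ i < m ] (∑[ j < n ] f i j) ≡ ∑[ j < n ] (∑[ i < m ] f i j)
  ∑-swap zero    n f = sym (trans (∑-const n 0ℤ) (ℤ.*-zeroʳ (+ n)))
  ∑-swap (suc m) n f =
    trans (cong (_+ ∑ n (f m)) (∑-swap m n f))
          (sym (∑-distrib-+ n (λ j → ∑[ i < m ] f i j) (f m)))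

  ∑-split : ∀ m n f → ∑ (m ℕ.+ n) f ≡ ∑ m f + ∑[ i < n ] f (m ℕ.+ i)
  ∑-split m zero    f = trans (cong (λ k → ∑ k f) (ℕ.+-identityʳ m)) (sym (ℤ.+-identityʳ _))
  ∑-split m (suc n) f =
    trans (cong (λ k → ∑ k f) (ℕ.+-suc m n))
          (trans (cong (_+ f (m ℕ.+ n)) (∑-split m n f)) (ℤ.+-assoc (∑ m f) _ _))

  ∑-zero : ∀ n {f} → (∀ i → i ℕ.< n → f i ≡ 0ℤ) → ∑ n f ≡ 0ℤ
  ∑-zero n eq = trans (∑-cong-< n eq) (trans (∑-const n 0ℤ) (ℤ.*-zeroʳ (+ n)))

  ∑-nonneg : ∀ n {f} → (∀ i → 0ℤ ≤ f i) → 0ℤ ≤ ∑ n f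
  ∑-nonneg n nn = ℤ.≤-trans (ℤ.≤-reflexive (sym (∑-zero n (λ _ _ → refl)))) (∑-mono n nn)

  ∑-upper : ∀ n c {f} → (∀ i → i ℕ.< n → f i ≤ c) → ∑ n f ≤ + n * c
  ∑-upper n c le = ℤ.≤-trans (∑-mono-< n le) (ℤ.≤-reflexive (∑-const n c))

  ∑-lower : ∀ n c {f} → (∀ i → i ℕ.< n → c ≤ f i) → + n * c ≤ ∑ n f
  ∑-lower n c le = ℤ.≤-trans (ℤ.≤-reflexive (sym (∑-const n c))) (∑-mono-< n le)

  -- Both sides come from cutting the same sum of `s + n` terms, once after `s` terms and once after
  -- `n`.
  ∑-telescope : ∀ s n f →
    ∑ n f - ∑[ i < n ] f (s ℕ.+ i) ≡ ∑ s f - ∑[ i < s ] f (n ℕ.+ i)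
  ∑-telescope s n f = cancel (∑ n f) (∑[ i < s ] f (n ℕ.+ i)) (∑ s f) (∑[ i < n ] f (s ℕ.+ i))
    (trans (sym (∑-split n s f)) (trans (cong (λ k → ∑ k f) (ℕ.+-comm n s)) (∑-split s n f)))
    where
    cancel : ∀ a b c d → a + b ≡ c + d → a - d ≡ c - b
    cancel a b c d eq = trans (lhs a b d) (trans (cong (λ k → k - b - d) eq) (rhs b c d))
      where
      lhs : ∀ a b d → a - d ≡ a + b - b - d
      lhs = solve-∀
      rhs : ∀ b c d → c + d - b - d ≡ c - b
      rhs = solve-∀

  module _ {f : ℕ → ℤ} (0≤f : ∀ i → 0ℤ ≤ f i) (f≤1 : ∀ i → f i ≤ 1ℤ) where

    private
      ∑≤ : ∀ s (g : ℕ → ℕ) → ∑[ i < s ] f (g i) ≤ + s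
      ∑≤ s g = ℤ.≤-trans (∑-upper s 1ℤ (λ i _ → f≤1 (g i))) (ℤ.≤-reflexive (ℤ.*-identityʳ (+ s)))

    -- Telescoping leaves two blocks of `s` terms, each with sum between 0 and `s`. The bound is
    -- therefore independent of `n`, and is `s` rather than `2s`.
    ∑-drift-upper : ∀ s n → ∑ n f - ∑[ i < n ] f (s ℕ.+ i) ≤ + s
    ∑-drift-upper s n = subst (_≤ + s) (sym (∑-telescope s n f))
      (≤-diff (eq (∑ s f) (∑[ i < s ] f (n ℕ.+ i)) (+ s)) (0≤+ (gap (∑≤ s (λ i → i))) (∑-nonneg s (λ i → 0≤f (n ℕ.+ i)))))
      where
      eq : ∀ a b c → c ≡ a - b + (c - a + b)
      eq = solve-∀

    ∑-drift-lower : ∀ s n → - (+ s) ≤ ∑ n f - ∑[ i < n ] f (s ℕ.+ i)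
    ∑-drift-lower s n = subst (- (+ s) ≤_) (sym (∑-telescope s n f))
      (≤-diff (eq (∑ s f) (∑[ i < s ] f (n ℕ.+ i)) (+ s)) (0≤+ (gap (∑≤ s (λ i → n ℕ.+ i))) (∑-nonneg s (λ i → 0≤f i))))
      where
      eq : ∀ a b c → a - b ≡ - c + (c - b + a)
      eq = solve-∀

  -- The two end blocks left by telescoping consist of zeros. This is what makes translations exact
  -- later on.
  ∑-shift : ∀ t X f → (∀ i → i ℕ.< t → f i ≡ 0ℤ) → (∀ i → X ℕ.≤ i → f i ≡ 0ℤ) →
            ∑[ i < X ] f (t ℕ.+ i) ≡ ∑ X f
  ∑-shift t X f below above =
    sym (ℤ.i-j≡0⇒i≡j _ _ (trans (∑-telescope t X f)
      (cong₂ _-_ (∑-zero t below) (∑-zero t (λ i _ → above _ (ℕ.m≤m+n X i))))))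

  -- Expanding a second moment.

  -- Induction on `H`: the new term contributes one diagonal sum and twice `H` off-diagonal ones.
  -- Counting `H * H` off-diagonal pairs instead of `H * (H - 1)` leaves one spare `b` in each step,
  -- whence `0ℤ ≤ b`.
  square-∑-bound : ∀ L X H (g : ℕ → ℕ → ℕ → ℤ) a b → 0ℤ ≤ b →
    (∀ k → k ℕ.< H → ∑[ n < L ] (∑[ x < X ] (g k n x * g k n x)) ≤ a) →
    (∀ j k → j ℕ.< k → k ℕ.< H → ∑[ n < L ] (∑[ x < X ] (g j n x * g k n x)) ≤ b) →
    ∑[ n < L ] (∑[ x < X ] ((∑[ k < H ] g k n x) * (∑[ k < H ] g k n x)))
      ≤ + H * a + + H * + H * b
  square-∑-bound L X zero    g a b 0≤b diagonal off = ℤ.≤-reflexive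
    (trans (∑-zero L (λ n _ → ∑-zero X (λ x _ → refl))) (eq a b))
    where
    eq : ∀ a b → 0ℤ ≡ 0ℤ * a + 0ℤ * 0ℤ * b
    eq = solve-∀
  square-∑-bound L X (suc H) g a b 0≤b diagonal off =
    ≤-diff (trans (eq (+ H) a b ss sg gg) (cong (λ t → t + rest) (sym expand)))
      (0≤+ (0≤+ (0≤+ (gap ih) (gap cross)) (0≤+ (gap cross) (gap (diagonal H ℕ.≤-refl)))) 0≤b)
    where
    s : ℕ → ℕ → ℤ
    s n x = ∑[ k < H ] g k n x

    ∑∑ : (ℕ → ℕ → ℤ) → ℤ
    ∑∑ h = ∑[ n < L ] (∑[ x < X ] h n x)

    ss sg gg rest : ℤ
    ss = ∑∑ (λ n x → s n x * s n x)
    sg = ∑∑ (λ n x → s n x * g H n x)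
    gg = ∑∑ (λ n x → g H n x * g H n x)
    rest = (((+ H * a + + H * + H * b - ss) + (+ H * b - sg)) + ((+ H * b - sg) + (a - gg))) + b

    ih = square-∑-bound L X H g a b 0≤b
      (λ k k<H → diagonal k (ℕ.m<n⇒m<1+n k<H))
      (λ j k j<k k<H → off j k j<k (ℕ.m<n⇒m<1+n k<H))

    ∑∑-distrib-+ : ∀ h h′ → ∑∑ (λ n x → h n x + h′ n x) ≡ ∑∑ h + ∑∑ h′
    ∑∑-distrib-+ h h′ =
      trans (∑-cong L (λ n → ∑-distrib-+ X (h n) (h′ n))) (∑-distrib-+ L (λ n → ∑ X (h n)) (λ n → ∑ X (h′ n)))

    cross : sg ≤ + H * b
    cross = subst (_≤ + H * b)
      (trans (∑-swap H L _) (∑-cong L (λ n → trans (∑-swap H X _)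
        (∑-cong X (λ x → *-distribʳ-∑ H (g H n x) (λ k → g k n x))))))
      (∑-upper H b (λ j j<H → off j H j<H ℕ.≤-refl))

    binomial : ∀ a b → (a + b) * (a + b) ≡ (a * a + a * b) + (a * b + b * b)
    binomial = solve-∀

    expand : ∑∑ (λ n x → (s n x + g H n x) * (s n x + g H n x))
           ≡ (ss + sg) + (sg + gg)
    expand = trans (∑-cong L (λ n → ∑-cong X (λ x → binomial (s n x) (g H n x))))
      (trans (∑∑-distrib-+ (λ n x → s n x * s n x + s n x * g H n x)
                           (λ n x → s n x * g H n x + g H n x * g H n x))
             (cong₂ _+_ (∑∑-distrib-+ (λ n x → s n x * s n x) (λ n x → s n x * g H n x))
                        (∑∑-distrib-+ (λ n x → s n x * g H n x) (λ n x → g H n x * g H n x))))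

    eq : ∀ h a b u v w → (1ℤ + h) * a + (1ℤ + h) * (1ℤ + h) * b ≡
      ((u + v) + (v + w)) +
        (((h * a + h * h * b - u) + (h * b - v)) + ((h * b - v) + (a - w)) + b)
    eq = solve-∀

  _² : ℕ → ℕ
  m ² = m ℕ.* m

  -- Sums along progressions of step `q`.

  -- `f` is supported in the interval from `S` up to `X`, exclusive. A translation by at most `S`
  -- thus leaves its sum over `x < X` unchanged.
  module Indicator
    (f : ℕ → ℤ) (0≤f : ∀ x → 0ℤ ≤ f x) (f≤1 : ∀ x → f x ≤ 1ℤ)
    (S X q : ℕ)
    (below : ∀ x → x ℕ.< S → f x ≡ 0ℤ) (above : ∀ x → X ℕ.≤ x → f x ≡ 0ℤ)
    where

    α : ℤ
    α = ∑ X f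

    Φ : ℕ → ℕ → ℤ
    Φ R x = ∑[ j < R ] f (x ℕ.+ j ℕ.* q)

    0≤α : 0ℤ ≤ α
    0≤α = ∑-nonneg X 0≤f

    0≤Φ : ∀ R x → 0ℤ ≤ Φ R x
    0≤Φ R x = ∑-nonneg R (λ j → 0≤f (x ℕ.+ j ℕ.* q))

    Φ≤R : ∀ R x → Φ R x ≤ + R
    Φ≤R R x = ℤ.≤-trans (∑-upper R 1ℤ (λ j _ → f≤1 (x ℕ.+ j ℕ.* q)))
                        (ℤ.≤-reflexive (ℤ.*-identityʳ (+ R)))

    ∑f-shift : ∀ t → t ℕ.≤ S → ∑[ x < X ] f (t ℕ.+ x) ≡ α
    ∑f-shift t t≤S = ∑-shift t X f (λ i i<t → below i (ℕ.<-≤-trans i<t t≤S)) above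

    jq≤Rq : ∀ t {j R} → j ℕ.< R → t ℕ.+ j ℕ.* q ℕ.≤ t ℕ.+ R ℕ.* q
    jq≤Rq t j<R = ℕ.+-monoʳ-≤ t (ℕ.*-monoˡ-≤ q (ℕ.<⇒≤ j<R))

    ∑Φ-shift : ∀ R t → t ℕ.+ R ℕ.* q ℕ.≤ S → ∑[ x < X ] Φ R (t ℕ.+ x) ≡ + R * α
    ∑Φ-shift R t fits =
      trans (∑-swap X R (λ x j → f (t ℕ.+ x ℕ.+ j ℕ.* q)))
        (trans (∑-cong-< R (λ j j<R →
                  trans (∑-cong X (λ x → cong f (rearrange t x (j ℕ.* q))))
                        (∑f-shift (t ℕ.+ j ℕ.* q) (ℕ.≤-trans (jq≤Rq t j<R) fits))))
               (∑-const R α))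
      where
      rearrange : ∀ t x y → t ℕ.+ x ℕ.+ y ≡ t ℕ.+ y ℕ.+ x
      rearrange = ℕ-Solver.solve-∀

    Φ-below : ∀ R t x → x ℕ.< t → t ℕ.+ R ℕ.* q ℕ.≤ S → Φ R x ≡ 0ℤ
    Φ-below R t x x<t fits = ∑-zero R (λ j j<R → below (x ℕ.+ j ℕ.* q)
      (ℕ.<-≤-trans (ℕ.+-monoˡ-< (j ℕ.* q) x<t) (ℕ.≤-trans (jq≤Rq t j<R) fits)))

    Φ-above : ∀ R x → X ℕ.≤ x → Φ R x ≡ 0ℤ
    Φ-above R x X≤x = ∑-zero R (λ j _ → above (x ℕ.+ j ℕ.* q)
      (ℕ.≤-trans X≤x (ℕ.m≤m+n x (j ℕ.* q))))

    Φ-drift : ∀ R x i → Φ R x - Φ R (x ℕ.+ i ℕ.* q) ≤ + i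
    Φ-drift R x i = ℤ.≤-trans
      (ℤ.≤-reflexive (cong (λ t → Φ R x - t) (∑-cong R (λ j → cong f (rearrange x i j q)))))
      (∑-drift-upper {λ j → f (x ℕ.+ j ℕ.* q)} (λ j → 0≤f _) (λ j → f≤1 _) i R)
      where
      rearrange : ∀ x i j q → x ℕ.+ i ℕ.* q ℕ.+ j ℕ.* q ≡ x ℕ.+ (i ℕ.+ j) ℕ.* q
      rearrange = ℕ-Solver.solve-∀

    -- A progression of `K * M` terms is cut into `K` consecutive ones of `M` terms.
    Φ-multiple : ∀ M D → (∀ x → Φ M x ≤ D) → ∀ K x → Φ (K ℕ.* M) x ≤ + K * D
    Φ-multiple M D dense zero    x = ℤ.≤-reflexive (sym (ℤ.*-zeroˡ D))
    Φ-multiple M D dense (suc K) x =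
      ℤ.≤-trans (ℤ.≤-reflexive (∑-split M (K ℕ.* M) (λ j → f (x ℕ.+ j ℕ.* q))))
      (ℤ.≤-trans (ℤ.+-mono-≤ (dense x) (ℤ.≤-trans
          (ℤ.≤-reflexive (∑-cong (K ℕ.* M) (λ j → cong f (rearrange x M j q))))
          (Φ-multiple M D dense K (x ℕ.+ M ℕ.* q))))
        (ℤ.≤-reflexive (eq (+ K) D)))
      where
      rearrange : ∀ x i j q → x ℕ.+ (i ℕ.+ j) ℕ.* q ≡ x ℕ.+ i ℕ.* q ℕ.+ j ℕ.* q
      rearrange = ℕ-Solver.solve-∀
      eq : ∀ K D → D + K * D ≡ (1ℤ + K) * D
      eq = solve-∀

    -- With u = Φ M ≤ D and Φ R ≤ K D, the lower bound comes from (D - u)(K D - Φ R) ≥ 0;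
    -- u appears by averaging over the shifts by i q, which barely change Φ R.
    correlation : ∀ M K D t → (∀ x → Φ M x ≤ D) →
      M ℕ.* q ℕ.≤ S → t ℕ.+ K ℕ.* M ℕ.* q ℕ.≤ S →
      D * (+ (K ℕ.* M) * α) + (+ K * D - + M) * (+ M * α) - + X * (+ K * D * D)
        ≤ + M * (∑[ x < X ] (f x * Φ (K ℕ.* M) (t ℕ.+ x)))
    correlation M K D t dense fitsM fitsR =
      ℤ.≤-trans (ℤ.≤-reflexive (sym summed))
      (ℤ.≤-trans (∑-mono X pointwise)
      (ℤ.≤-trans (ℤ.≤-reflexive (sym exchange))
      (ℤ.≤-trans (∑-mono-< M (λ i i<M → ∑-mono X (drift i i<M)))
      (ℤ.≤-reflexive averaged))))
      where
      R = K ℕ.* M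
      E = + K * D

      averaged : ∑[ i < M ] (∑[ x < X ] (f (i ℕ.* q ℕ.+ x) * Φ R (t ℕ.+ (i ℕ.* q ℕ.+ x))))
               ≡ + M * (∑[ x < X ] (f x * Φ R (t ℕ.+ x)))
      averaged = trans
        (∑-cong-< M (λ i i<M → ∑-shift (i ℕ.* q) X (λ x → f x * Φ R (t ℕ.+ x))
          (λ x x<iq → vanish x (below x (ℕ.<-≤-trans x<iq
            (ℕ.≤-trans (ℕ.*-monoˡ-≤ q (ℕ.<⇒≤ i<M)) fitsM))))
          (λ x X≤x → vanish x (above x X≤x))))
        (∑-const M (∑[ x < X ] (f x * Φ R (t ℕ.+ x))))
        where
        vanish : ∀ x → f x ≡ 0ℤ → f x * Φ R (t ℕ.+ x) ≡ 0ℤ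
        vanish x fx≡0 = trans (cong (_* Φ R (t ℕ.+ x)) fx≡0) (ℤ.*-zeroˡ (Φ R (t ℕ.+ x)))

      -- Dropping the shift by `i * q` inside `Φ R` costs at most `i`. Charging `M` for every `i`
      -- makes the second factor independent of `i`, so that summing the first over `i` gives
      -- `Φ M x`.
      drift : ∀ i → i ℕ.< M → ∀ x →
        f (x ℕ.+ i ℕ.* q) * (Φ R (t ℕ.+ x) - + M)
          ≤ f (i ℕ.* q ℕ.+ x) * Φ R (t ℕ.+ (i ℕ.* q ℕ.+ x))
      drift i i<M x = ℤ.≤-trans
        (≤-diff (eq (f y) (Φ R z) (Φ R (z ℕ.+ i ℕ.* q)) (+ i) (+ M))
          (0≤* (0≤f y) (0≤+ (gap (Φ-drift R z i)) (gap (+≤+ (ℕ.<⇒≤ i<M))))))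
        (ℤ.≤-reflexive (cong₂ _*_ (cong f (ℕ.+-comm x (i ℕ.* q)))
          (cong (Φ R) (rearrange t x (i ℕ.* q)))))
        where
        y = x ℕ.+ i ℕ.* q
        z = t ℕ.+ x
        eq : ∀ f a b i M → f * b ≡ f * (a - M) + f * ((i - (a - b)) + (M - i))
        eq = solve-∀
        rearrange : ∀ t x y → t ℕ.+ x ℕ.+ y ≡ t ℕ.+ (y ℕ.+ x)
        rearrange = ℕ-Solver.solve-∀

      exchange : ∑[ i < M ] (∑[ x < X ] (f (x ℕ.+ i ℕ.* q) * (Φ R (t ℕ.+ x) - + M)))
               ≡ ∑[ x < X ] (Φ M x * (Φ R (t ℕ.+ x) - + M))
      exchange = trans
        (∑-swap M X (λ i x → f (x ℕ.+ i ℕ.* q) * (Φ R (t ℕ.+ x) - + M)))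
        (∑-cong X (λ x → *-distribʳ-∑ M (Φ R (t ℕ.+ x) - + M) (λ i → f (x ℕ.+ i ℕ.* q))))

      lower : ℕ → ℤ
      lower x = D * Φ R (t ℕ.+ x) + (E - + M) * Φ M x - E * D

      pointwise : ∀ x → lower x ≤ Φ M x * (Φ R (t ℕ.+ x) - + M)
      pointwise x = ≤-diff (eq D E (Φ M x) (Φ R (t ℕ.+ x)) (+ M))
        (0≤* (gap (dense x)) (gap (Φ-multiple M D dense K (t ℕ.+ x))))
        where
        eq : ∀ D E u v M → u * (v - M) ≡ (D * v + (E - M) * u - E * D) + (D - u) * (E - v)
        eq = solve-∀

      summed : ∑ X lower ≡ D * (+ R * α) + (E - + M) * (+ M * α) - + X * (E * D)
      summed = trans
        (∑-distrib-− X (λ x → D * Φ R (t ℕ.+ x) + (E - + M) * Φ M x) (λ _ → E * D))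
        (cong₂ _-_
          (trans (∑-distrib-+ X (λ x → D * Φ R (t ℕ.+ x)) (λ x → (E - + M) * Φ M x))
            (cong₂ _+_
              (trans (*-distribˡ-∑ X D (λ x → Φ R (t ℕ.+ x))) (cong (D *_) (∑Φ-shift R t fitsR)))
              (trans (*-distribˡ-∑ X (E - + M) (Φ M))
                     (cong ((E - + M) *_) (∑Φ-shift M 0 fitsM)))))
          (∑-const X (E * D)))

    -- The balanced function and its correlations.

    module Balanced (R : ℕ) where

      G : ℕ → ℤ
      G x = + R * f x - Φ R x

      -- A majorant of the absolute value of `G`, since both summands are nonnegative; its total is
      -- `mass`.
      E : ℕ → ℤ
      E x = + R * f x + Φ R x

      0≤R : 0ℤ ≤ + R
      0≤R = +≤+ z≤n

      mass : ℤ
      mass = + 2 * (+ R * α)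

      ∑E : R ℕ.* q ℕ.≤ S → ∑ X E ≡ mass
      ∑E fits = trans (∑-distrib-+ X (λ x → + R * f x) (Φ R))
        (trans (cong₂ _+_ (*-distribˡ-∑ X (+ R) f) (∑Φ-shift R 0 fits)) (eq (+ R * α)))
        where
        eq : ∀ a → a + a ≡ + 2 * a
        eq = solve-∀

      G-below : ∀ t x → x ℕ.< t → t ℕ.+ R ℕ.* q ℕ.≤ S → G x ≡ 0ℤ
      G-below t x x<t fits = trans
        (cong₂ (λ a b → + R * a - b)
          (below x (ℕ.<-≤-trans x<t (ℕ.≤-trans (ℕ.m≤m+n t (R ℕ.* q)) fits)))
          (Φ-below R t x x<t fits))
        (eq (+ R))
        where
        eq : ∀ R → R * 0ℤ - 0ℤ ≡ 0ℤ
        eq = solve-∀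

      G-above : ∀ x → X ℕ.≤ x → G x ≡ 0ℤ
      G-above x X≤x = trans
        (cong₂ (λ a b → + R * a - b) (above x X≤x) (Φ-above R x X≤x)) (eq (+ R))
        where
        eq : ∀ R → R * 0ℤ - 0ℤ ≡ 0ℤ
        eq = solve-∀

      ∑G-shift : ∀ t (h : ℕ → ℤ) → t ℕ.+ R ℕ.* q ℕ.≤ S →
        ∑[ x < X ] (G (t ℕ.+ x) * h (t ℕ.+ x)) ≡ ∑[ x < X ] (G x * h x)
      ∑G-shift t h fits = ∑-shift t X (λ x → G x * h x)
        (λ x x<t → vanish x (G-below t x x<t fits)) (λ x X≤x → vanish x (G-above x X≤x))
        where
        vanish : ∀ x → G x ≡ 0ℤ → G x * h x ≡ 0ℤ
        vanish x Gx≡0 = trans (cong (_* h x) Gx≡0) (ℤ.*-zeroˡ (h x))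

      -- The absolute value of `G` is at most `R` and also at most `E`, so `G² ≤ R * E` pointwise.
      ∑G² : ∀ t → t ℕ.+ R ℕ.* q ℕ.≤ S →
        ∑[ x < X ] (G (t ℕ.+ x) * G (t ℕ.+ x)) ≤ + R * mass
      ∑G² t fits = ℤ.≤-trans (ℤ.≤-reflexive (∑G-shift t G fits))
        (ℤ.≤-trans (∑-mono X pointwise)
        (ℤ.≤-reflexive (trans (*-distribˡ-∑ X (+ R) E)
          (cong (+ R *_) (∑E (ℕ.≤-trans (ℕ.m≤n+m (R ℕ.* q) t) fits))))))
        where
        pointwise : ∀ x → G x * G x ≤ + R * E x
        pointwise x = ≤-diff (eq (+ R) (f x) (Φ R x))
          (0≤+ (0≤+ (0≤* (0≤* 0≤R 0≤R) (0≤* (0≤f x) (gap (f≤1 x))))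
                    (0≤* (0≤Φ R x) (gap (Φ≤R R x))))
               (0≤* (0≤+ 0≤R 0≤R) (0≤* (0≤f x) (0≤Φ R x))))
          where
          eq : ∀ R f u → R * (R * f + u) ≡ (R * f - u) * (R * f - u)
            + ((R * R * (f * (1ℤ - f)) + u * (R - u)) + (R + R) * (f * u))
          eq = solve-∀

      G-differences : ∀ y → G y ≡ ∑[ j < R ] (f y - f (y ℕ.+ j ℕ.* q))
      G-differences y = sym (trans (∑-distrib-− R (λ _ → f y) (λ j → f (y ℕ.+ j ℕ.* q)))
        (cong (_- Φ R y) (∑-const R (f y))))

      -- The sum telescopes because the step s divides q.
      progression-sum : ∀ L z s c → 1 ℕ.≤ s → c ℕ.* s ≡ q →
        - (+ R * + (R ℕ.* q)) ≤ ∑[ n < L ] G (z ℕ.+ n ℕ.* s) ×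
        ∑[ n < L ] G (z ℕ.+ n ℕ.* s) ≤ + R * + (R ℕ.* q)
      progression-sum L z s c 1≤s cs≡q =
        ℤ.≤-trans (ℤ.≤-reflexive (ℤ.neg-distribʳ-* (+ R) (+ (R ℕ.* q))))
          (ℤ.≤-trans (∑-lower R (- (+ (R ℕ.* q))) (λ j j<R → ℤ.≤-trans
              (ℤ.neg-mono-≤ (+≤+ (jc≤Rq j<R)))
              (∑-drift-lower (λ n → 0≤f _) (λ n → f≤1 _) (j ℕ.* c) L)))
            (ℤ.≤-reflexive (sym exchange)))
        , ℤ.≤-trans (ℤ.≤-reflexive exchange)
          (∑-upper R (+ (R ℕ.* q)) (λ j j<R → ℤ.≤-trans
              (∑-drift-upper (λ n → 0≤f _) (λ n → f≤1 _) (j ℕ.* c) L)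
              (+≤+ (jc≤Rq j<R))))
        where
        F : ℕ → ℤ
        F n = f (z ℕ.+ n ℕ.* s)

        jc≤Rq : ∀ {j} → j ℕ.< R → j ℕ.* c ℕ.≤ R ℕ.* q
        jc≤Rq j<R = ℕ.*-mono-≤ (ℕ.<⇒≤ j<R)
          (subst (c ℕ.≤_) cs≡q (ℕ.m≤m*n c s {{ℕ.>-nonZero 1≤s}}))

        shifted : ∀ j n → z ℕ.+ n ℕ.* s ℕ.+ j ℕ.* q ≡ z ℕ.+ (j ℕ.* c ℕ.+ n) ℕ.* s
        shifted j n = trans (cong (λ t → z ℕ.+ n ℕ.* s ℕ.+ j ℕ.* t) (sym cs≡q)) (eq z n s j c)
          where
          eq : ∀ z n s j c → z ℕ.+ n ℕ.* s ℕ.+ j ℕ.* (c ℕ.* s) ≡ z ℕ.+ (j ℕ.* c ℕ.+ n) ℕ.* s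
          eq = ℕ-Solver.solve-∀

        exchange : ∑[ n < L ] G (z ℕ.+ n ℕ.* s)
                 ≡ ∑[ j < R ] (∑ L F - ∑[ n < L ] F (j ℕ.* c ℕ.+ n))
        exchange = trans (∑-cong L (λ n → trans (G-differences (z ℕ.+ n ℕ.* s))
              (∑-cong R (λ j → cong (λ t → F n - f t) (shifted j n)))))
          (trans (∑-swap L R (λ n j → F n - F (j ℕ.* c ℕ.+ n)))
            (∑-cong R (λ j → ∑-distrib-− L F (λ n → F (j ℕ.* c ℕ.+ n)))))

      -- The difference of the shifts `b n` and `a n` is linear in `n`. After translating by `a n`,
      -- the sum over `n` acts on the second factor alone and runs along a progression of step `s`,
      -- where `progression-sum` bounds it by `B`; the first factor is majorised by `E`.
      off-diagonal : ∀ L (a b : ℕ → ℕ) e s c → 1 ℕ.≤ s → c ℕ.* s ≡ q →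
        R ℕ.* q ℕ.≤ S →
        (∀ n → n ℕ.< L → a n ℕ.+ R ℕ.* q ℕ.≤ S) → (∀ n → b n ≡ a n ℕ.+ (e ℕ.+ n ℕ.* s)) →
        ∑[ n < L ] (∑[ x < X ] (G (a n ℕ.+ x) * G (b n ℕ.+ x))) ≤ + R * + (R ℕ.* q) * mass
      off-diagonal L a b e s c 1≤s cs≡q fits₀ fits b≡ =
        ℤ.≤-trans (ℤ.≤-reflexive exchange)
        (ℤ.≤-trans (∑-mono X pointwise)
        (ℤ.≤-reflexive (trans (*-distribˡ-∑ X B E) (cong (B *_) (∑E fits₀)))))
        where
        B = + R * + (R ℕ.* q)

        I : ℕ → ℤ
        I y = ∑[ n < L ] G (y ℕ.+ e ℕ.+ n ℕ.* s)

        rearrange : ∀ a e x t → a ℕ.+ (e ℕ.+ t) ℕ.+ x ≡ a ℕ.+ x ℕ.+ e ℕ.+ t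
        rearrange = ℕ-Solver.solve-∀

        exchange : ∑[ n < L ] (∑[ x < X ] (G (a n ℕ.+ x) * G (b n ℕ.+ x)))
                 ≡ ∑[ y < X ] (G y * I y)
        exchange = trans
          (∑-cong-< L (λ n n<L → trans
            (∑-cong X (λ x → cong (λ t → G (a n ℕ.+ x) * G t)
              (trans (cong (ℕ._+ x) (b≡ n)) (rearrange (a n) e x (n ℕ.* s)))))
            (∑G-shift (a n) (λ y → G (y ℕ.+ e ℕ.+ n ℕ.* s)) (fits n n<L))))
          (trans (∑-swap L X (λ n y → G y * G (y ℕ.+ e ℕ.+ n ℕ.* s)))
            (∑-cong X (λ y → *-distribˡ-∑ L (G y) (λ n → G (y ℕ.+ e ℕ.+ n ℕ.* s)))))

        pointwise : ∀ y → G y * I y ≤ B * E y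
        pointwise y with progression-sum L (y ℕ.+ e) s c 1≤s cs≡q
        -- `G y` is a difference of two nonnegative terms: the positive one is paired with the upper
        -- bound for `I y`, the negative one with the lower bound.
        ... | lo , hi = ≤-diff (eq (+ R) (f y) (Φ R y) (I y) B)
          (0≤+ (0≤* (0≤* 0≤R (0≤f y)) (gap hi)) (0≤* (0≤Φ R y) (gap lo)))
          where
          eq : ∀ R f u I B → B * (R * f + u) ≡
            (R * f - u) * I + (R * f * (B - I) + u * (I - - B))
          eq = solve-∀

      -- Van der Corput differencing over the squares.

      module Moment (H L : ℕ)
        (fits : (H ℕ.+ L) ² ℕ.+ R ℕ.* q ℕ.≤ S)
        (factor : ∀ h → 1 ℕ.≤ h → h ℕ.< H → ∃ λ c → c ℕ.* (2 ℕ.* h) ≡ q)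
        where

        square-fits : ∀ {k n} → k ℕ.< H → n ℕ.< L → suc (n ℕ.+ k) ² ℕ.+ R ℕ.* q ℕ.≤ S
        square-fits {k} {n} k<H n<L = ℕ.≤-trans
          (ℕ.+-monoˡ-≤ (R ℕ.* q) (ℕ.*-mono-≤ le le)) fits
          where
          le : suc (n ℕ.+ k) ℕ.≤ H ℕ.+ L
          le = subst (suc (n ℕ.+ k) ℕ.≤_) (ℕ.+-comm L H) (ℕ.+-mono-≤ n<L (ℕ.<⇒≤ k<H))

        fits₀ : R ℕ.* q ℕ.≤ S
        fits₀ = ℕ.≤-trans (ℕ.m≤n+m (R ℕ.* q) ((H ℕ.+ L) ²)) fits

        -- The successor keeps every shift a nonzero square.
        g : ℕ → ℕ → ℕ → ℤ
        g k n x = G (suc (n ℕ.+ k) ² ℕ.+ x)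

        V : ℤ
        V = ∑[ n < L ] (∑[ x < X ] ((∑[ k < H ] g k n x) * (∑[ k < H ] g k n x)))

        0≤mass : 0ℤ ≤ mass
        0≤mass = 0≤* {+ 2} (+≤+ z≤n) (0≤* 0≤R 0≤α)

        V-upper : V ≤ + H * (+ L * (+ R * mass)) + + H * + H * (+ R * + (R ℕ.* q) * mass)
        V-upper = square-∑-bound L X H g (+ L * (+ R * mass)) (+ R * + (R ℕ.* q) * mass)
          (0≤* (0≤* 0≤R (+≤+ z≤n)) 0≤mass)
          (λ k k<H → ∑-upper L (+ R * mass) (λ n n<L → ∑G² (suc (n ℕ.+ k) ²) (square-fits k<H n<L)))
          off
          where
          off : ∀ j k → j ℕ.< k → k ℕ.< H →
            ∑[ n < L ] (∑[ x < X ] (g j n x * g k n x)) ≤ + R * + (R ℕ.* q) * mass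
          -- With `m = n + j + 1` and `h = k - j = o + 1`, the shifts differ by
          -- `(m + h)² - m² = h² + 2hm`, which is linear in `n` with step `2h`.
          off j k j<k k<H with ℕ.m≤n⇒∃[o]m+o≡n j<k
          ... | o , refl with factor (suc o) (s≤s z≤n) (ℕ.≤-<-trans (ℕ.s≤s (ℕ.m≤n+m o j)) k<H)
          ... | c , c*2h≡q = off-diagonal L _ _ (h ² ℕ.+ 2 ℕ.* h ℕ.* suc j) (2 ℕ.* h) c
            (s≤s z≤n) c*2h≡q fits₀ (λ n n<L → square-fits (ℕ.<-trans j<k k<H) n<L) (λ n → eq n j o)
            where
            h = suc o
            eq : ∀ n j o → suc (n ℕ.+ (suc j ℕ.+ o)) ℕ.* suc (n ℕ.+ (suc j ℕ.+ o)) ≡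
              suc (n ℕ.+ j) ℕ.* suc (n ℕ.+ j) ℕ.+
                (suc o ℕ.* suc o ℕ.+ 2 ℕ.* suc o ℕ.* suc j ℕ.+ n ℕ.* (2 ℕ.* suc o))
            eq = ℕ-Solver.solve-∀

        -- s² ≥ - 2 c f s - c² f for 0 ≤ f ≤ 1, with c = H w the expected
        -- size of - s on the support of f.
        V-lower : ∀ w → 0ℤ ≤ w →
          (∀ {k n} → k ℕ.< H → n ℕ.< L → ∑[ x < X ] (f x * g k n x) ≤ - (w * α)) →
          + L * (+ H * w * (+ H * w) * α) ≤ V
        V-lower w 0≤w bound = ∑-lower L (c * c * α) (λ n n<L →
            ℤ.≤-trans (row n n<L) (ℤ.≤-trans (ℤ.≤-reflexive (sym (summed n))) (∑-mono X (pointwise n))))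
          where
          c = + H * w

          0≤c : 0ℤ ≤ c
          0≤c = 0≤* {+ H} (+≤+ z≤n) 0≤w

          s : ℕ → ℕ → ℤ
          s n x = ∑[ k < H ] g k n x

          pointwise : ∀ n x → - (c + c) * (f x * s n x) - c * c * f x ≤ s n x * s n x
          pointwise n x = ≤-diff (eq (f x) (s n x) c)
            (0≤+ (0≤* (gap (f≤1 x)) (0≤² (s n x))) (0≤* (0≤f x) (0≤² (s n x + c))))
            where
            eq : ∀ f s c → s * s ≡ (- (c + c) * (f * s) - c * c * f) +
              ((1ℤ - f) * (s * s) + f * ((s + c) * (s + c)))
            eq = solve-∀

          correlationSum : ℕ → ℤ
          correlationSum n = ∑[ x < X ] (f x * s n x)

          correlationSum-upper : ∀ n → n ℕ.< L → correlationSum n ≤ + H * - (w * α)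
          correlationSum-upper n n<L = ℤ.≤-trans
            (ℤ.≤-reflexive (trans (∑-cong X (λ x → sym (*-distribˡ-∑ H (f x) (λ k → g k n x))))
              (∑-swap X H (λ x k → f x * g k n x))))
            (∑-upper H (- (w * α)) (λ k k<H → bound k<H n<L))

          summed : ∀ n → ∑[ x < X ] (- (c + c) * (f x * s n x) - c * c * f x)
                       ≡ - (c + c) * correlationSum n - c * c * α
          summed n = trans
            (∑-distrib-− X (λ x → - (c + c) * (f x * s n x)) (λ x → c * c * f x))
            (cong₂ _-_ (*-distribˡ-∑ X (- (c + c)) (λ x → f x * s n x)) (*-distribˡ-∑ X (c * c) f))

          -- As `correlationSum n` is at most `- (c * α)`, the first term is at least `2c²α`;
          -- subtracting `c²α` leaves `c²α`.
          row : ∀ n → n ℕ.< L → c * c * α ≤ - (c + c) * correlationSum n - c * c * α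
          row n n<L = ≤-diff (eq (+ H) w α (correlationSum n))
            (0≤* (0≤+ 0≤c 0≤c) (gap (correlationSum-upper n n<L)))
            where
            eq : ∀ H w α T → - (H * w + H * w) * T - H * w * (H * w) * α ≡
              H * w * (H * w) * α + (H * w + H * w) * (H * - (w * α) - T)
            eq = solve-∀

    -- Comparing the two bounds for the second moment.

    -- This is `correlation` with `K = 4M`, whose left side is `8M²Dα - 4MXD² - M²α`. The density
    -- hypothesis bounds the middle term by `6M²Dα`, and `D ≥ 1` lets the remaining `2M²Dα` absorb
    -- the drift loss `M²α` with `M²α` to spare.
    correlation-lower : ∀ M D t → 0ℤ ≤ D - 1ℤ → (∀ x → Φ M x ≤ D) →
      0ℤ < + M → + 2 * (D * + X) ≤ + 3 * (α * + M) →
      M ℕ.* q ℕ.≤ S → t ℕ.+ 4 ℕ.* M ℕ.* M ℕ.* q ℕ.≤ S →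
      + M * α ≤ ∑[ x < X ] (f x * Φ (4 ℕ.* M ℕ.* M) (t ℕ.+ x))
    correlation-lower M D t 0≤D-1 dense 0<M dX≤αM fitsM fitsR =
      ℤ.*-cancelˡ-≤-pos (+ M * α) W (+ M) {{ℤ.positive 0<M}}
        (ℤ.≤-trans (≤-diff expand (0≤* (ℤ.<⇒≤ 0<M) (0≤+
            (0≤* (0≤+ 0≤D 0≤D) (gap dX≤αM))
            (0≤* (0≤* {+ 2} (+≤+ z≤n) (0≤* (ℤ.<⇒≤ 0<M) 0≤α)) 0≤D-1))))
          (correlation M (4 ℕ.* M) D t dense fitsM fitsR))
      where
      W = ∑[ x < X ] (f x * Φ (4 ℕ.* M ℕ.* M) (t ℕ.+ x))

      0≤D : 0ℤ ≤ D
      0≤D = ℤ.≤-trans {j = 1ℤ} (+≤+ z≤n) (ℤ.0≤i-j⇒j≤i 0≤D-1)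

      expand : D * (+ (4 ℕ.* M ℕ.* M) * α) + (+ (4 ℕ.* M) * D - + M) * (+ M * α)
                 - + X * (+ (4 ℕ.* M) * D * D)
             ≡ + M * (+ M * α) + + M * ((D + D) * (+ 3 * (α * + M) - + 2 * (D * + X))
                 + + 2 * (+ M * α) * (D - 1ℤ))
      expand = cast _ _ (trans (ℤ.pos-* (4 ℕ.* M) M) (cong (_* + M) (ℤ.pos-* 4 M))) (ℤ.pos-* 4 M)
        where
        eq : ∀ D M α X → D * (+ 4 * M * M * α) + (+ 4 * M * D - M) * (M * α) - X * (+ 4 * M * D * D)
           ≡ M * (M * α) + M * ((D + D) * (+ 3 * (α * M) - + 2 * (D * X))
                 + + 2 * (M * α) * (D - 1ℤ))
        eq = solve-∀

        cast : ∀ R K → R ≡ + 4 * + M * + M → K ≡ + 4 * + M →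
          D * (R * α) + (K * D - + M) * (+ M * α) - + X * (K * D * D)
            ≡ + M * (+ M * α) + + M * ((D + D) * (+ 3 * (α * + M) - + 2 * (D * + X))
                + + 2 * (+ M * α) * (D - 1ℤ))
        cast _ _ refl refl = eq D (+ M) α (+ X)

    -- Without square differences, `f` correlates with each shifted `G` by at most `-Mα`, so the
    -- second moment is at least `L(HM)²α`. The upper bound is `64HLM⁴α`. Cancelling `P = HLM²α`
    -- gives `H ≤ 64M²`.
    square-difference-unavoidable : ∀ M D H → 0ℤ ≤ D - 1ℤ → (∀ x → Φ M x ≤ D) →
      0 ℕ.< M → 0ℤ < α → 0 ℕ.< q → 64 ℕ.* M ℕ.* M ℕ.< H →
      + 2 * (D * + X) ≤ + 3 * (α * + M) →
      (H ℕ.+ H ℕ.* (4 ℕ.* M ℕ.* M ℕ.* q)) ² ℕ.+ 4 ℕ.* M ℕ.* M ℕ.* q ℕ.≤ S →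
      (∀ h → 1 ℕ.≤ h → h ℕ.< H → ∃ λ c → c ℕ.* (2 ℕ.* h) ≡ q) →
      (∀ m x → f x * f (suc m ² ℕ.+ x) ≡ 0ℤ) → ⊥
    square-difference-unavoidable M D H 0≤D-1 dense 0<M 0<α 0<q large dX≤αM fits factor free =
      ℕ.<⇒≱ large (ℤ.drop‿+≤+ H≤64M²)
      where
      R = 4 ℕ.* M ℕ.* M
      -- This length makes the diagonal and off-diagonal contributions to `V-upper` equal.
      L = H ℕ.* (R ℕ.* q)
      open Balanced R
      open Moment H L fits factor

      0<M⁺ : 0ℤ < + M
      0<M⁺ = +<+ 0<M

      M≤R : M ℕ.≤ R
      M≤R = ℕ.m≤n*m M (4 ℕ.* M) {{ℕ.>-nonZero (ℕ.*-mono-≤ {1} {4} (s≤s z≤n) 0<M)}}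

      bound : ∀ {k n} → k ℕ.< H → n ℕ.< L → ∑[ x < X ] (f x * g k n x) ≤ - (+ M * α)
      bound {k} {n} k<H n<L = ℤ.≤-trans (ℤ.≤-reflexive negated)
        (ℤ.neg-mono-≤ (correlation-lower M D t 0≤D-1 dense 0<M⁺ dX≤αM
          (ℕ.≤-trans (ℕ.*-monoˡ-≤ q M≤R) fits₀) (square-fits k<H n<L)))
        where
        t = suc (n ℕ.+ k) ²

        -- The product of `f x` and `f (t + x)` vanishes by `free`, since `t` is a nonzero square;
        -- only the `Φ R` part of `G` survives.
        pointwise : ∀ x → f x * G (t ℕ.+ x) ≡ - 1ℤ * (f x * Φ R (t ℕ.+ x))
        pointwise x = trans (eq (f x) (f (t ℕ.+ x)) (Φ R (t ℕ.+ x)) (+ R))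
          (trans (cong (λ z → + R * z - f x * Φ R (t ℕ.+ x)) (free (n ℕ.+ k) x))
                 (eq′ (+ R) (f x * Φ R (t ℕ.+ x))))
          where
          eq : ∀ f f′ u R → f * (R * f′ - u) ≡ R * (f * f′) - f * u
          eq = solve-∀
          eq′ : ∀ R u → R * 0ℤ - u ≡ - 1ℤ * u
          eq′ = solve-∀

        negated : ∑[ x < X ] (f x * G (t ℕ.+ x)) ≡ - (∑[ x < X ] (f x * Φ R (t ℕ.+ x)))
        negated = trans (∑-cong X pointwise)
          (trans (*-distribˡ-∑ X (- 1ℤ) (λ x → f x * Φ R (t ℕ.+ x)))
                 (ℤ.-1*i≡-i (∑[ x < X ] (f x * Φ R (t ℕ.+ x)))))

      P : ℤ
      P = + H * + L * (+ M * + M * α)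

      0<P : 0ℤ < P
      0<P = 0<* (0<* 0<H 0<L) (0<* (0<* 0<M⁺ 0<M⁺) 0<α)
        where
        0<H : 0ℤ < + H
        0<H = +<+ (ℕ.≤-<-trans z≤n large)
        0<L : 0ℤ < + L
        0<L = +<+ (ℕ.*-mono-≤ {1} {H} (ℕ.≤-<-trans z≤n large)
          (ℕ.*-mono-≤ {1} {R} (ℕ.≤-trans 0<M M≤R) 0<q))

      collect : + H * (+ L * (+ R * mass)) + + H * + H * (+ R * + (R ℕ.* q) * mass)
              ≡ P * + (64 ℕ.* M ℕ.* M)
      collect = cast _ _ _ (ℤ.pos-* H (R ℕ.* q))
        (trans (ℤ.pos-* (4 ℕ.* M) M) (cong (_* + M) (ℤ.pos-* 4 M)))
        (trans (ℤ.pos-* (64 ℕ.* M) M) (cong (_* + M) (ℤ.pos-* 64 M)))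
        where
        eq : ∀ H u M α →
          H * (H * u * (+ 4 * M * M * (+ 2 * (+ 4 * M * M * α)))) +
            H * H * (+ 4 * M * M * u * (+ 2 * (+ 4 * M * M * α)))
          ≡ H * (H * u) * (M * M * α) * (+ 64 * M * M)
        eq = solve-∀

        cast : ∀ l r m → l ≡ + H * + (R ℕ.* q) → r ≡ + 4 * + M * + M → m ≡ + 64 * + M * + M →
          + H * (l * (r * (+ 2 * (r * α)))) + + H * + H * (r * + (R ℕ.* q) * (+ 2 * (r * α)))
            ≡ + H * l * (+ M * + M * α) * m
        cast _ _ _ refl refl refl = eq (+ H) (+ (R ℕ.* q)) (+ M) α

      H≤64M² : + H ≤ + (64 ℕ.* M ℕ.* M)
      H≤64M² = ℤ.*-cancelˡ-≤-pos (+ H) (+ (64 ℕ.* M ℕ.* M)) P {{ℤ.positive 0<P}}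
        (ℤ.≤-trans (ℤ.≤-reflexive (eq (+ H) (+ L) (+ M) α))
        (ℤ.≤-trans (V-lower (+ M) (+≤+ z≤n) bound)
        (ℤ.≤-trans V-upper (ℤ.≤-reflexive collect))))
        where
        eq : ∀ H L M α → H * L * (M * M * α) * H ≡ L * (H * M * (H * M) * α)
        eq = solve-∀

  -- From square-difference-free sets to indicator functions.

  𝟙 : ∀ {P : Set} → Dec P → ℤ
  𝟙 (yes _) = 1ℤ
  𝟙 (no  _) = 0ℤ

  0≤𝟙 : ∀ {P : Set} (P? : Dec P) → 0ℤ ≤ 𝟙 P?
  0≤𝟙 (yes _) = +≤+ z≤n
  0≤𝟙 (no  _) = +≤+ z≤n

  𝟙≤1 : ∀ {P : Set} (P? : Dec P) → 𝟙 P? ≤ 1ℤ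
  𝟙≤1 (yes _) = +≤+ (s≤s z≤n)
  𝟙≤1 (no  _) = +≤+ z≤n

  𝟙-no : ∀ {P : Set} (P? : Dec P) → ¬ P → 𝟙 P? ≡ 0ℤ
  𝟙-no (yes p) ¬p = contradiction p ¬p
  𝟙-no (no  _) ¬p = refl

  𝟙-disjoint : ∀ {P Q : Set} (P? : Dec P) (Q? : Dec Q) → (P → ¬ Q) → 𝟙 P? * 𝟙 Q? ≡ 0ℤ
  𝟙-disjoint (yes p) (yes q) ¬pq = contradiction q (¬pq p)
  𝟙-disjoint (yes _) (no  _) ¬pq = refl
  𝟙-disjoint (no  _) (yes _) ¬pq = refl
  𝟙-disjoint (no  _) (no  _) ¬pq = refl

  𝟙-∷ : ∀ a A → a ∉ A → ∀ x → 𝟙 (x ∈? (a ∷ A)) ≡ 𝟙 (x ℕ.≟ a) + 𝟙 (x ∈? A)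
  𝟙-∷ a A a∉A x with x ℕ.≟ a | x ∈? A
  ... | yes refl | yes x∈A = contradiction x∈A a∉A
  ... | yes refl | no  _   = refl
  ... | no  _    | yes _   = refl
  ... | no  _    | no  _   = refl

  ∑-𝟙-≟ : ∀ X a → a ℕ.< X → ∑[ x < X ] 𝟙 (x ℕ.≟ a) ≡ 1ℤ
  ∑-𝟙-≟ (suc X) a a<1+X with X ℕ.≟ a
  ... | yes refl = cong (_+ 1ℤ) (∑-zero X (λ x x<X → 𝟙-no (x ℕ.≟ X) (ℕ.<⇒≢ x<X)))
  ... | no  X≢a  = cong (_+ 0ℤ) (∑-𝟙-≟ X a (ℕ.≤∧≢⇒< (ℕ.s≤s⁻¹ a<1+X) (λ a≡X → X≢a (sym a≡X))))

  ∑-𝟙-∈ : ∀ X A → Unique A → All (ℕ._< X) A → ∑[ x < X ] 𝟙 (x ∈? A) ≡ + length A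
  ∑-𝟙-∈ X []      []            []            = ∑-zero X (λ _ _ → refl)
  ∑-𝟙-∈ X (a ∷ A) (a≢A ∷ unique) (a<X ∷ A<X) =
    trans (∑-cong X (𝟙-∷ a A (All.All¬⇒¬Any a≢A)))
      (trans (∑-distrib-+ X (λ x → 𝟙 (x ℕ.≟ a)) (λ x → 𝟙 (x ∈? A)))
             (cong₂ _+_ (∑-𝟙-≟ X a a<X) (∑-𝟙-∈ X A unique A<X)))

  -- Sums are indexed from 0, whereas the sets counted by `IsD` start at 1; hence the successor.
  Position : (ℕ → Set) → ℕ → ℕ → Set
  Position P n b = ∃ λ j → b ≡ suc j × j ℕ.< n × P j

  -- Turns a count into an explicit list, to which the maximality in `IsD` can be applied.
  ∑-𝟙-enumerate : ∀ {P : ℕ → Set} (P? : Decidable P) n → ∃ λ B →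
    ∑[ j < n ] 𝟙 (P? j) ≡ + length B × Unique B × All (Position P n) B
  ∑-𝟙-enumerate P? zero = [] , refl , [] , []
  ∑-𝟙-enumerate {P} P? (suc n) with ∑-𝟙-enumerate P? n
  ... | B , count , unique , inB with P? n
  ...   | no _   = B , trans (ℤ.+-identityʳ _) count , unique , All.map weaken inB
    where
    weaken : ∀ {b} → Position P n b → Position P (suc n) b
    weaken (j , b≡1+j , j<n , Pj) = j , b≡1+j , ℕ.m<n⇒m<1+n j<n , Pj
  ...   | yes Pn = suc n ∷ B
      , trans (cong (_+ 1ℤ) count) (cong +_ (ℕ.+-comm (length B) 1))
      , All.map fresh inB ∷ unique
      , (n , refl , ℕ.≤-refl , Pn) ∷ All.map weaken inB
    where
    weaken : ∀ {b} → Position P n b → Position P (suc n) b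
    weaken (j , b≡1+j , j<n , Pj) = j , b≡1+j , ℕ.m<n⇒m<1+n j<n , Pj
    fresh : ∀ {b} → Position P n b → suc n ≢ b
    fresh (j , refl , j<n , _) refl = ℕ.<-irrefl refl j<n

  NoSquareDifference : List ℕ → Set
  NoSquareDifference A = ∀ {a a'} → a ∈ A → a' ∈ A → ∀ n → 1 ℕ.≤ n → a ≢ a' ℕ.+ n ^ 2

  -- Dilating by the square d² maps square differences to square differences.
  progression-density : ∀ A → NoSquareDifference A → ∀ d → 1 ℕ.≤ d → ∀ M dM → IsD M dM →
    ∀ x → ∑[ j < M ] 𝟙 ((x ℕ.+ j ℕ.* (d ℕ.* d)) ∈? A) ≤ + dM
  progression-density A free d 1≤d M dM (_ , maximal) x
    with ∑-𝟙-enumerate (λ j → (x ℕ.+ j ℕ.* (d ℕ.* d)) ∈? A) M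
  ... | B , count , unique , inB =
    ℤ.≤-trans (ℤ.≤-reflexive count) (+≤+ (maximal B record
      { unique   = unique
      ; inRange  = All.map (λ { (j , refl , j<M , _) → s≤s z≤n , j<M }) inB
      ; noSquare = noSquare
      }))
    where
    eq : ∀ x j n d → x ℕ.+ (j ℕ.+ n ℕ.* (n ℕ.* 1)) ℕ.* (d ℕ.* d)
      ≡ x ℕ.+ j ℕ.* (d ℕ.* d) ℕ.+ (n ℕ.* d) ℕ.* ((n ℕ.* d) ℕ.* 1)
    eq = ℕ-Solver.solve-∀

    noSquare : NoSquareDifference B
    noSquare b∈B b'∈B n 1≤n b≡b'+n² with All.lookup inB b∈B | All.lookup inB b'∈B
    ... | j , refl , _ , Pj | j' , refl , _ , Pj' = free Pj Pj' (n ℕ.* d) (ℕ.*-mono-≤ 1≤n 1≤d)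
      (trans (cong (λ t → x ℕ.+ t ℕ.* (d ℕ.* d)) (ℕ.suc-injective b≡b'+n²)) (eq x j' n d))

  translate-free : ∀ S A → NoSquareDifference A → NoSquareDifference (map (S ℕ.+_) A)
  translate-free S A free a∈ a'∈ n 1≤n a≡a'+n² with ∈-map⁻ (S ℕ.+_) a∈ | ∈-map⁻ (S ℕ.+_) a'∈
  ... | b , b∈A , refl | b' , b'∈A , refl =
    free b∈A b'∈A n 1≤n (ℕ.+-cancelˡ-≡ S b (b' ℕ.+ n ^ 2) (trans a≡a'+n² (ℕ.+-assoc S b' (n ^ 2))))

  -- The singleton of 1 is admissible.
  D-positive : ∀ M dM → 1 ℕ.≤ M → IsD M dM → 1 ℕ.≤ dM
  D-positive M dM 1≤M (_ , maximal) = maximal (1 ∷ []) record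
    { unique   = [] ∷ []
    ; inRange  = (ℕ.≤-refl , 1≤M) ∷ []
    ; noSquare = λ { (here refl) (here refl) n 1≤n 1≡1+n² →
        ℕ.<⇒≢ (ℕ.*-mono-≤ 1≤n (ℕ.*-mono-≤ 1≤n ℕ.≤-refl)) (ℕ.suc-injective 1≡1+n²) }
    }

  -- Divisibility and size of the parameters.

  1+n≤2^n : ∀ n → suc n ℕ.≤ 2 ^ n
  1+n≤2^n zero    = ℕ.≤-refl
  1+n≤2^n (suc n) = ℕ.≤-trans (ℕ.+-mono-≤ (ℕ.m^n>0 2 n) (1+n≤2^n n))
    (ℕ.≤-reflexive (eq (2 ^ n)))
    where
    eq : ∀ t → t ℕ.+ t ≡ 2 ℕ.* t
    eq = ℕ-Solver.solve-∀

  n!≤2^n² : ∀ n → n ! ℕ.≤ 2 ^ (n ℕ.* n)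
  n!≤2^n² zero = ℕ.≤-refl
  n!≤2^n² (suc n) = ℕ.≤-trans (ℕ.*-mono-≤ (1+n≤2^n n) (n!≤2^n² n))
    (ℕ.≤-trans (ℕ.≤-reflexive (sym (ℕ.^-distribˡ-+-* 2 n (n ℕ.* n))))
               (ℕ.^-monoʳ-≤ 2 (ℕ.+-mono-≤ (ℕ.n≤1+n n) (ℕ.*-monoʳ-≤ n (ℕ.n≤1+n n)))))

  -- One factor `H !` supplies the 2 and the other supplies `h`.
  factorial-square-divisible : ∀ H → 2 ℕ.≤ H → ∀ h → 1 ℕ.≤ h → h ℕ.< H →
    ∃ λ c → c ℕ.* (2 ℕ.* h) ≡ H ! ℕ.* H !
  factorial-square-divisible H 2≤H (suc h) _ h<H
    with *-pres-∣ (m≤n⇒m!∣n! 2≤H) (∣-trans (m∣m*n (h !)) (m≤n⇒m!∣n! (ℕ.<⇒≤ h<H)))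
  ... | divides c eq = c , sym eq

  -- Everything is measured in powers of `T`: with `P = T⁴`, the side of the square is at most `2P`,
  -- while 1 and `R * q` are at most `P²`. The total is at most `8 * 6P² = 48P² ≤ T⁹`.
  window-bound : ∀ T H R q → 48 ℕ.≤ T → H ℕ.≤ T → R ℕ.≤ T → q ℕ.≤ T ℕ.* T →
    8 ℕ.* suc ((H ℕ.+ H ℕ.* (R ℕ.* q)) ² ℕ.+ R ℕ.* q) ℕ.≤ T ^ 9
  window-bound T H R q 48≤T H≤T R≤T q≤T² = begin
    8 ℕ.* suc ((H ℕ.+ H ℕ.* (R ℕ.* q)) ² ℕ.+ R ℕ.* q)
      ≤⟨ ℕ.*-monoʳ-≤ 8 (ℕ.+-mono-≤ 1≤P² (ℕ.+-mono-≤ (ℕ.*-mono-≤ side side) cube)) ⟩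
    8 ℕ.* (P ² ℕ.+ ((P ℕ.+ P) ² ℕ.+ P ²))
      ≡⟨ eq P ⟩
    48 ℕ.* P ²
      ≤⟨ ℕ.*-monoˡ-≤ (P ²) 48≤T ⟩
    T ℕ.* P ²
      ≡⟨ eq′ T ⟩
    T ^ 9 ∎
    where
    open ℕ.≤-Reasoning
    P = T ℕ.* (T ℕ.* (T ℕ.* T))

    1≤T : 1 ℕ.≤ T
    1≤T = ℕ.≤-trans (s≤s z≤n) 48≤T

    1≤T³ : 1 ℕ.≤ T ℕ.* (T ℕ.* T)
    1≤T³ = ℕ.*-mono-≤ 1≤T (ℕ.*-mono-≤ 1≤T 1≤T)

    1≤P : 1 ℕ.≤ P
    1≤P = ℕ.*-mono-≤ 1≤T 1≤T³

    1≤P² : 1 ℕ.≤ P ²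
    1≤P² = ℕ.*-mono-≤ 1≤P 1≤P

    Rq≤T³ : R ℕ.* q ℕ.≤ T ℕ.* (T ℕ.* T)
    Rq≤T³ = ℕ.*-mono-≤ R≤T q≤T²

    side : H ℕ.+ H ℕ.* (R ℕ.* q) ℕ.≤ P ℕ.+ P
    side = ℕ.+-mono-≤
      (ℕ.≤-trans H≤T (ℕ.m≤m*n T (T ℕ.* (T ℕ.* T)) {{ℕ.>-nonZero 1≤T³}}))
      (ℕ.*-mono-≤ H≤T Rq≤T³)

    cube : R ℕ.* q ℕ.≤ P ²
    cube = ℕ.≤-trans Rq≤T³ (ℕ.≤-trans
      (ℕ.m≤n*m (T ℕ.* (T ℕ.* T)) T {{ℕ.>-nonZero 1≤T}})
      (ℕ.m≤m*n P P {{ℕ.>-nonZero 1≤P}}))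

    eq : ∀ P → 8 ℕ.* (P ℕ.* P ℕ.+ ((P ℕ.+ P) ℕ.* (P ℕ.+ P) ℕ.+ P ℕ.* P)) ≡ 48 ℕ.* (P ℕ.* P)
    eq = ℕ-Solver.solve-∀

    eq′ : ∀ T → T ℕ.* (T ℕ.* (T ℕ.* (T ℕ.* T)) ℕ.* (T ℕ.* (T ℕ.* (T ℕ.* T))))
      ≡ T ℕ.* (T ℕ.* (T ℕ.* (T ℕ.* (T ℕ.* (T ℕ.* (T ℕ.* (T ℕ.* (T ℕ.* 1))))))))
    eq′ = ℕ-Solver.solve-∀

  -- The least `H` that exceeds `64M²`, as the contradiction requires.
  scale : ℕ → ℕ
  scale M = suc (64 ℕ.* M ℕ.* M)

  modulus : ℕ → ℕ
  modulus M = scale M ! ℕ.* scale M !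

  -- The largest shift of the indicator that occurs. Translating A by it keeps the support inside
  -- the range of summation, so that no boundary terms arise.
  window : ℕ → ℕ
  window M = (scale M ℕ.+ scale M ℕ.* (4 ℕ.* M ℕ.* M ℕ.* modulus M)) ² ℕ.+ 4 ℕ.* M ℕ.* M ℕ.* modulus M

  scale-upper : ∀ M → 1 ℕ.≤ M → scale M ℕ.≤ 65 ℕ.* M ℕ.* M
  scale-upper M 1≤M = ℕ.≤-trans (ℕ.+-monoˡ-≤ (64 ℕ.* M ℕ.* M) (ℕ.*-mono-≤ 1≤M 1≤M))
    (ℕ.≤-reflexive (eq M))
    where
    eq : ∀ M → M ℕ.* M ℕ.+ 64 ℕ.* M ℕ.* M ≡ 65 ℕ.* M ℕ.* M
    eq = ℕ-Solver.solve-∀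

  64≤64M² : ∀ M → 1 ℕ.≤ M → 64 ℕ.≤ 64 ℕ.* M ℕ.* M
  64≤64M² M 1≤M = ℕ.*-mono-≤ {64} {64 ℕ.* M} {1} (ℕ.m≤m*n 64 M {{ℕ.>-nonZero 1≤M}}) 1≤M

  -- With `T = 2 ^ (H * H)` the window bound is `2 ^ (9H²)`. Since `H ≤ 65M²`, the exponent is at
  -- most `9 * 65² * M⁴`, and `M⁴ ≤ M⁷`.
  window-upper : ∀ M → 1 ℕ.≤ M → 8 ℕ.* suc (window M) ℕ.≤ 2 ^ (9 ℕ.* (65 ℕ.* 65) ℕ.* M ^ 7)
  window-upper M 1≤M = begin
    8 ℕ.* suc (window M)
      ≤⟨ window-bound T H (4 ℕ.* M ℕ.* M) (modulus M)
           (ℕ.≤-trans (ℕ.m≤n+m 48 16) (ℕ.≤-trans (64≤64M² M 1≤M) (ℕ.≤-trans (ℕ.n≤1+n _) H≤T)))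
           H≤T
           (ℕ.≤-trans (ℕ.*-monoˡ-≤ M (ℕ.*-monoˡ-≤ M (ℕ.m≤m+n 4 60))) (ℕ.≤-trans (ℕ.n≤1+n _) H≤T))
           (ℕ.*-mono-≤ (n!≤2^n² H) (n!≤2^n² H)) ⟩
    T ^ 9
      ≡⟨ ℕ.^-*-assoc 2 (H ℕ.* H) 9 ⟩
    2 ^ (H ℕ.* H ℕ.* 9)
      ≤⟨ ℕ.^-monoʳ-≤ 2 exponent ⟩
    2 ^ (9 ℕ.* (65 ℕ.* 65) ℕ.* M ^ 7) ∎
    where
    open ℕ.≤-Reasoning
    H = scale M
    T = 2 ^ (H ℕ.* H)

    H≤T : H ℕ.≤ T
    H≤T = ℕ.≤-trans (ℕ.n≤1+n H) (ℕ.≤-trans (1+n≤2^n H) (ℕ.^-monoʳ-≤ 2 (ℕ.m≤m*n H H)))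

    eq : ∀ M → 65 ℕ.* M ℕ.* M ℕ.* (65 ℕ.* M ℕ.* M) ℕ.* 9
      ≡ 9 ℕ.* (65 ℕ.* 65) ℕ.* (M ℕ.* (M ℕ.* (M ℕ.* (M ℕ.* 1))))
    eq = ℕ-Solver.solve-∀

    exponent : H ℕ.* H ℕ.* 9 ℕ.≤ 9 ℕ.* (65 ℕ.* 65) ℕ.* M ^ 7
    exponent = ℕ.≤-trans
      (ℕ.*-monoˡ-≤ 9 (ℕ.*-mono-≤ (scale-upper M 1≤M) (scale-upper M 1≤M)))
      (ℕ.≤-trans (ℕ.≤-reflexive (eq M))
        (ℕ.*-monoʳ-≤ (9 ℕ.* (65 ℕ.* 65)) (ℕ.^-monoʳ-≤ M {{ℕ.>-nonZero 1≤M}} (ℕ.m≤m+n 4 3))))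

  -- Translating the set and concluding.

  -- The window takes up at most an eighth of `N`, so enlarging the range from `N` to `X` multiplies
  -- it by at most 9/8. The factor 3/4 thereby becomes 2/3, the density that
  -- `square-difference-unavoidable` assumes.
  no-increment : ∀ M N dM dN → 1 ℕ.≤ M → 8 ℕ.* suc (window M) ℕ.≤ N → IsD M dM → IsD N dN →
    ¬ (3 ℕ.* dM ℕ.* N ℕ.< 4 ℕ.* dN ℕ.* M)
  no-increment M N dM dN 1≤M large isDM ((A , squareFree , ∣A∣≡dN) , _) dense =
    square-difference-unavoidable M (+ dM) H (gap (+≤+ (D-positive M dM 1≤M isDM)))
      (progression-density A⁺ free (H !) (ℕ.1≤n! H) M dM isDM)
      1≤M (subst (0ℤ <_) (sym α≡dN) (+<+ 0<dN)) (ℕ.*-mono-≤ (ℕ.1≤n! H) (ℕ.1≤n! H)) ℕ.≤-refl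
      crowded ℕ.≤-refl
      (factorial-square-divisible H (ℕ.≤-trans (ℕ.m≤m+n 2 62) (ℕ.≤-trans (64≤64M² M 1≤M) (ℕ.n≤1+n _))))
      (λ m x → 𝟙-disjoint (x ∈? A⁺) ((suc m ² ℕ.+ x) ∈? A⁺)
        (λ x∈A x+m²∈A → free x+m²∈A x∈A (suc m) (s≤s z≤n) (eq m x)))
    where
    open SquareDiffFree squareFree
    H = scale M
    S = window M
    -- The translated set lies between `S + 1` and `S + N`, and the range of summation excludes its
    -- endpoint.
    X = suc (S ℕ.+ N)

    A⁺ : List ℕ
    A⁺ = map (S ℕ.+_) A

    free : NoSquareDifference A⁺
    free = translate-free S A noSquare

    eq : ∀ m x → suc m ℕ.* suc m ℕ.+ x ≡ x ℕ.+ suc m ℕ.* (suc m ℕ.* 1)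
    eq = ℕ-Solver.solve-∀

    S≤A⁺ : All (S ℕ.≤_) A⁺
    S≤A⁺ = All.map⁺ (All.map (λ {a} _ → ℕ.m≤m+n S a) inRange)

    A⁺<X : All (ℕ._< X) A⁺
    A⁺<X = All.map⁺ (All.map (λ (_ , a≤N) → s≤s (ℕ.+-monoʳ-≤ S a≤N)) inRange)

    open Indicator (λ x → 𝟙 (x ∈? A⁺)) (λ x → 0≤𝟙 (x ∈? A⁺)) (λ x → 𝟙≤1 (x ∈? A⁺)) S X (modulus M)
      (λ x x<S → 𝟙-no (x ∈? A⁺) (λ x∈A → ℕ.<⇒≱ x<S (All.lookup S≤A⁺ x∈A)))
      (λ x X≤x → 𝟙-no (x ∈? A⁺) (λ x∈A → ℕ.<⇒≱ (All.lookup A⁺<X x∈A) X≤x))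

    α≡dN : α ≡ + dN
    α≡dN = trans (∑-𝟙-∈ X A⁺ (Unique.map⁺ (ℕ.+-cancelˡ-≡ S _ _) unique) A⁺<X)
      (cong +_ (trans (length-map (S ℕ.+_) A) ∣A∣≡dN))

    0<dN : 0 ℕ.< dN
    0<dN = ℕ.n≢0⇒n>0 (λ { refl → ℕ.n≮0 dense })

    8X≤9N : 8 ℕ.* X ℕ.≤ 9 ℕ.* N
    8X≤9N = ℕ.≤-trans (ℕ.≤-reflexive (expand S N)) (ℕ.+-monoˡ-≤ (8 ℕ.* N) large)
      where
      expand : ∀ S N → 8 ℕ.* suc (S ℕ.+ N) ≡ 8 ℕ.* suc S ℕ.+ 8 ℕ.* N
      expand = ℕ-Solver.solve-∀

    crowdedℕ : 2 ℕ.* (dM ℕ.* X) ℕ.≤ 3 ℕ.* (dN ℕ.* M)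
    crowdedℕ = ℕ.*-cancelˡ-≤ 8 (begin
      8 ℕ.* (2 ℕ.* (dM ℕ.* X))   ≡⟨ lhs dM X ⟩
      2 ℕ.* dM ℕ.* (8 ℕ.* X)     ≤⟨ ℕ.*-monoʳ-≤ (2 ℕ.* dM) 8X≤9N ⟩
      2 ℕ.* dM ℕ.* (9 ℕ.* N)     ≡⟨ middle dM N ⟩
      6 ℕ.* (3 ℕ.* dM ℕ.* N)     ≤⟨ ℕ.*-monoʳ-≤ 6 (ℕ.<⇒≤ dense) ⟩
      6 ℕ.* (4 ℕ.* dN ℕ.* M)     ≡⟨ rhs dN M ⟩
      8 ℕ.* (3 ℕ.* (dN ℕ.* M))   ∎)
      where
      open ℕ.≤-Reasoning
      lhs : ∀ d X → 8 ℕ.* (2 ℕ.* (d ℕ.* X)) ≡ 2 ℕ.* d ℕ.* (8 ℕ.* X)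
      lhs = ℕ-Solver.solve-∀
      middle : ∀ d N → 2 ℕ.* d ℕ.* (9 ℕ.* N) ≡ 6 ℕ.* (3 ℕ.* d ℕ.* N)
      middle = ℕ-Solver.solve-∀
      rhs : ∀ d M → 6 ℕ.* (4 ℕ.* d ℕ.* M) ≡ 8 ℕ.* (3 ℕ.* (d ℕ.* M))
      rhs = ℕ-Solver.solve-∀

    crowded : + 2 * (+ dM * + X) ≤ + 3 * (α * + M)
    crowded = subst₂ _≤_
      (trans (ℤ.pos-* 2 (dM ℕ.* X)) (cong (+ 2 *_) (ℤ.pos-* dM X)))
      (trans (ℤ.pos-* 3 (dN ℕ.* M)) (cong (+ 3 *_)
        (trans (ℤ.pos-* dN M) (cong (_* + M) (sym α≡dN)))))
      (+≤+ crowdedℕ)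

open SquareDifferences using (no-increment; window-upper)
open import Data.Nat using (ℕ; _*_; _^_; _≤_; _<_)

-- Base 2 in place of e only rescales the constant by log 2, and the inequality of densities is
-- cross-multiplied.
theorem2 : ∃₂ λ (C M₀ : ℕ) → 0 < C × ∀ M N → M₀ ≤ M → 2 ^ (C * M ^ 7) ≤ N →
    ∀ dM dN → IsD M dM → IsD N dN → 4 * dN * M ≤ 3 * dM * N
-- The 9 is the power of `T` in `window-bound`, and 65 comes from `scale M ≤ 65M²`, which holds from
-- `M = 1` on.
theorem2 = 9 * (65 * 65) , 1 , ℕ.z<s , λ M N 1≤M large dM dN isDM isDN →
  ℕ.≮⇒≥ (no-increment M N dM dN 1≤M (ℕ.≤-trans (window-upper M 1≤M) large) isDM isDN)
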